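{- Let $G$ be a finite connected graph. If $G$ is a partial cube, then the relation $\varphi$ on $E(G)$ coincides with the Djoković–Winkler relation $\theta$, is an equivalence relation on $E(G)$, and its classes are exactly the Djoković cuts of $G$. Conversely, if $G$ is bipartite, $\varphi$ is an equivalence relation on $E(G)$, and each $\varphi$-class induces an edge cut with convex sides, then $G$ is a partial cube and its $\theta$-classes are equal to its $\varphi$-classes.
   Context: $d=d_G$ is the shortest-path metric of the finite connected graph $G$. For edges $e=\{u,v\}$ and $f=\{x,y\}$ of $G$: - $e\,\varphi\,f$ means $d(u,x)=d(v,y)$ and $d(u,y)=d(v,x)$ (this does not depend on how the endpoints are named). - $e\,\theta\,f$ (Djoković–Winkler relation) means $d(u,x)+d(v,y)\ne d(u,y)+d(v,x)$. A partial cube is a graph $G$ admitting an isometric (distance-preserving) map of its vertices into a hypercube $Q_p$, i.e. binary labels in $\mathbb{Z}_2^p$ under which graph distance equals Hamming distance. For an edge $\{u,v\}$ let $W_{uv}=\{w\in V(G): d(w,u)<d(w,v)\}$ and $W_{vu}=\{w: d(w,v)<d(w,u)\}$; the Djoković cut of $\{u,v\}$ in a partial cube is the set of edges with one end in $W_{uv}$ and the other in $W_{vu}$. A set $F\subseteq E(G)$ induces an edge cut with convex sides if there is a partition $V(G)=A_F\sqcup B_F$ such that $F$ is exactly the set of edges with one end in $A_F$ and the other in $B_F$, and both $A_F$ and $B_F$ are convex (a vertex set is convex if it contains every vertex of every shortest path of $G$ between two of its members). -}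

module Defs where

open import Level using (0ℓ)
open import Data.Bool using (Bool)
import Data.Bool.Properties as Bool
open import Data.Fin using (Fin)
open import Data.Fin.Properties using (any?) renaming (_≟_ to _≟F_)
open import Data.Fin.Subset using (Subset; ∁) renaming (_∈_ to _∈ₛ_)
open import Data.Nat using (ℕ; zero; suc; _+_; _≤_; _<_; z≤n; s≤s)
open import Data.Nat.Properties using (+-comm)
open import Data.Product using (∃; ∃-syntax; Σ-syntax; _×_; _,_; proj₁; proj₂; swap)
open import Data.Sum using (_⊎_) renaming (swap to ⊎-swap; map to ⊎-map)
open import Data.Vec using (Vec; count; zip)
open import Function using (_∘_)
open import Relation.Binary using (Rel; Symmetric) renaming (Decidable to Decidable₂)
open import Relation.Binary.PropositionalEquality using (_≡_; _≢_; refl; sym; trans; ≢-sym)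
open import Relation.Nullary using (¬_; yes; no; contradiction)
open import Relation.Nullary.Decidable using (map′; ¬?; _×-dec_)
open import Relation.Unary using (Pred; Decidable; _≐_)

least : {P : Pred ℕ 0ℓ} → Decidable P → ∀ {m} → P m →
        ∃[ k ] (P k × (∀ {j} → P j → k ≤ j))
least     P? {zero}  p = zero , p , λ _ → z≤n
least {P} P? {suc m} p with P? zero
... | yes p₀ = zero , p₀ , λ _ → z≤n
... | no ¬p₀ with least (P? ∘ suc) p
...   | k , pk , min = suc k , pk , bound _
  where
  bound : ∀ j → P j → suc k ≤ j
  bound zero    q = contradiction q ¬p₀
  bound (suc _) q = s≤s (min q)

record Graph (n : ℕ) : Set₁ where
  infix 4 _~_ _~?_
  field
    _~_      : Rel (Fin n) 0ℓ
    _~?_     : Decidable₂ _~_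
    ~-sym    : Symmetric _~_
    ~-irrefl : ∀ {u} → ¬ (u ~ u)

hamming : ∀ {p} → Vec Bool p → Vec Bool p → ℕ
hamming x y = count (λ ab → ¬? (proj₁ ab Bool.≟ proj₂ ab)) (zip x y)

-- For an equivalence relation R: F is one of the classes of R.
IsClassOf : {E : Set} → Rel E 0ℓ → Pred E 0ℓ → Set
IsClassOf R F = ∃[ e ] (F ≐ R e)

module _ {n : ℕ} (G : Graph n) where

  open Graph G

  data Walk : Fin n → Fin n → ℕ → Set where
    []  : ∀ {u} → Walk u u zero
    _∷_ : ∀ {u w v k} → u ~ w → Walk w v k → Walk u v (suc k)

  data _∈ʷ_ (x : Fin n) : ∀ {u v k} → Walk u v k → Set where
    end   : x ∈ʷ ([] {x})
    here  : ∀ {w v k} {a : x ~ w} {p : Walk w v k} → x ∈ʷ (a ∷ p)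
    there : ∀ {u w v k} {a : u ~ w} {p : Walk w v k} → x ∈ʷ p → x ∈ʷ (a ∷ p)

  walk? : ∀ u v → Decidable (Walk u v)
  walk? u v zero = map′ (λ { refl → [] }) (λ { [] → refl }) (u ≟F v)
  walk? u v (suc k) =
    map′ (λ { (_ , a , p) → a ∷ p }) (λ { (a ∷ p) → _ , a , p })
         (any? λ w → (u ~? w) ×-dec walk? w v k)

  Connected : Set
  Connected = ∀ u v → ∃ (Walk u v)

  Bipartite : Set
  Bipartite = Σ[ c ∈ (Fin n → Bool) ] (∀ {u v} → u ~ v → c u ≢ c v)

  -- An edge together with a naming of its endpoints: each edge {u , v} occurs
  -- both as (u , v) and as (v , u).  Relations and sets of edges below do not
  -- distinguish the two, see the flip lemmas.
  record Edge : Set where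
    constructor edge
    field
      src tgt : Fin n
      adj     : src ~ tgt

  open Edge public

  flip : Edge → Edge
  flip (edge u v a) = edge v u (~-sym a)

  Between : Pred (Fin n) 0ℓ → Pred (Fin n) 0ℓ → Pred Edge 0ℓ
  Between A B f = (A (src f) × B (tgt f)) ⊎ (B (src f) × A (tgt f))

  Between-flip : ∀ {A B f} → Between A B f → Between A B (flip f)
  Between-flip = ⊎-swap ∘ ⊎-map swap swap

  module Metric (conn : Connected) where

    dist : Fin n → Fin n → ℕ
    dist u v = proj₁ (least (walk? u v) (proj₂ (conn u v)))

    geodesic : ∀ u v → Walk u v (dist u v)
    geodesic u v = proj₁ (proj₂ (least (walk? u v) (proj₂ (conn u v))))

    dist-minimal : ∀ {u v k} → Walk u v k → dist u v ≤ k
    dist-minimal {u} {v} = proj₂ (proj₂ (least (walk? u v) (proj₂ (conn u v))))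

    φ : Rel Edge 0ℓ
    φ (edge u v _) (edge x y _) = dist u x ≡ dist v y × dist u y ≡ dist v x

    θ : Rel Edge 0ℓ
    θ (edge u v _) (edge x y _) = dist u x + dist v y ≢ dist u y + dist v x

    IsPartialCube : Set
    IsPartialCube =
      ∃[ p ] Σ[ label ∈ (Fin n → Vec Bool p) ]
        (∀ u v → dist u v ≡ hamming (label u) (label v))

    W : Fin n → Fin n → Pred (Fin n) 0ℓ
    W u v w = dist w u < dist w v

    djokovićCut : Edge → Pred Edge 0ℓ
    djokovićCut (edge u v _) = Between (W u v) (W v u)

    IsDjokovićCut : Pred Edge 0ℓ → Set
    IsDjokovićCut F = ∃[ e ] (F ≐ djokovićCut e)

    Convex : Subset n → Set
    Convex A = ∀ {u v} → u ∈ₛ A → v ∈ₛ A →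
               (p : Walk u v (dist u v)) → ∀ {w} → w ∈ʷ p → w ∈ₛ A

    InducesConvexEdgeCut : Pred Edge 0ℓ → Set
    InducesConvexEdgeCut F =
      ∃[ A ] (F ≐ Between (_∈ₛ A) (_∈ₛ ∁ A) × Convex A × Convex (∁ A))

    φ-flipˡ : ∀ {e f} → φ e f → φ (flip e) f
    φ-flipˡ (p , q) = sym q , sym p

    φ-flipʳ : ∀ {e f} → φ e f → φ e (flip f)
    φ-flipʳ = swap

    θ-flipˡ : ∀ {e f} → θ e f → θ (flip e) f
    θ-flipˡ {edge u v _} {edge x y _} ne eq =
      ne (trans (+-comm (dist u x) _) (trans (sym eq) (+-comm (dist v x) _)))

    θ-flipʳ : ∀ {e f} → θ e f → θ e (flip f)
    θ-flipʳ = ≢-sym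

{-# OPTIONS --safe #-}

-- In a partial cube an edge e = {u , v} flips exactly one coordinate i, and for
-- every vertex w the distances d(u , w) and d(v , w) differ by one, the smaller
-- being the one whose endpoint agrees with w in coordinate i.  Hence φ e f,
-- θ e f and "f lies in the Djoković cut of e" all say that f flips i too.
-- Conversely, label a vertex by its sides of the convex cuts of the φ-classes,
-- one coordinate per class.  Adjacent labels differ exactly in the class of
-- the edge.  By convexity the first edge of a geodesic crosses a cut that the
-- rest of the geodesic does not cross, so the Hamming distance of the endpoints
-- of a geodesic drops by one with each step.
module Submission where

open import Defs
open import Level using (0ℓ)
open import Data.Bool using (Bool; true; false)
import Data.Bool.Properties as Bool
open import Data.Fin using (Fin; zero; suc)
open import Data.Fin.Subset using (∁) renaming (_∈_ to _∈ₛ_)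
open import Data.Fin.Subset.Properties using (_∈?_; x∈∁p⇒x∉p; x∉p⇒x∈∁p)
open import Data.List using (List; []; _∷_; length; concatMap; cartesianProduct; allFin; deduplicate)
open import Data.List.Membership.Propositional using (lose)
open import Data.List.Membership.Propositional.Properties using (∈-cartesianProduct⁺; ∈-allFin)
open import Data.List.Relation.Unary.All as All using (All; []; _∷_)
open import Data.List.Relation.Unary.AllPairs as AllPairs using (AllPairs; _∷_)
open import Data.List.Relation.Unary.Any as Any using (Any; here; there)
open import Data.List.Relation.Unary.Any.Properties using (concatMap⁺; deduplicate⁺)
open import Data.List.Relation.Unary.Unique.DecSetoid.Properties using (deduplicate-!)
open import Data.Nat using (ℕ; zero; suc; _+_; _≟_; s≤s⁻¹)
open import Data.Nat.Properties
open import Data.Product using (∃-syntax; _×_; _,_; proj₁; proj₂)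
open import Data.Sum using (_⊎_; inj₁; inj₂)
open import Data.Vec using (Vec; []; _∷_; lookup; map; fromList)
open import Data.Vec.Properties using (lookup-map; []=⇒lookup; lookup⇒[]=)
open import Function using (_∘_)
open import Function.Bundles using (_⇔_; mk⇔)
open import Relation.Binary using (Rel; IsEquivalence; DecSetoid)
open import Relation.Binary.PropositionalEquality
open import Relation.Nullary using (¬_; Dec; yes; no; contradiction)
open import Relation.Nullary.Decidable using (decidable-stable; _×-dec_)
open import Relation.Unary using (Pred; _≐_)
open import Relation.Unary.Properties using (≐-sym; ≐-trans)

-- Hamming distance of Boolean vectors.

hamming-sym : ∀ {p} (x y : Vec Bool p) → hamming x y ≡ hamming y x
hamming-sym []          []          = refl
hamming-sym (true  ∷ x) (true  ∷ y) = hamming-sym x y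
hamming-sym (true  ∷ x) (false ∷ y) = cong suc (hamming-sym x y)
hamming-sym (false ∷ x) (true  ∷ y) = cong suc (hamming-sym x y)
hamming-sym (false ∷ x) (false ∷ y) = hamming-sym x y

hamming≡0⇒≡ : ∀ {p} (x y : Vec Bool p) → hamming x y ≡ 0 → x ≡ y
hamming≡0⇒≡ []          []          _ = refl
hamming≡0⇒≡ (true  ∷ x) (true  ∷ y) h = cong (true ∷_) (hamming≡0⇒≡ x y h)
hamming≡0⇒≡ (false ∷ x) (false ∷ y) h = cong (false ∷_) (hamming≡0⇒≡ x y h)

hamming-refl : ∀ {p} (x : Vec Bool p) → hamming x x ≡ 0
hamming-refl []          = refl
hamming-refl (true  ∷ x) = hamming-refl x
hamming-refl (false ∷ x) = hamming-refl x

hamming≢0⇒differ : ∀ {p} (x y : Vec Bool p) → hamming x y ≢ 0 →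
                   ∃[ i ] lookup x i ≢ lookup y i
hamming≢0⇒differ []      []      h = contradiction refl h
hamming≢0⇒differ (a ∷ x) (b ∷ y) h with a Bool.≟ b
... | no a≢b = zero , a≢b
... | yes _ with hamming≢0⇒differ x y h
...   | i , ne = suc i , ne

-- Distance one leaves `i` as the only coordinate where `x` and `y` differ. Elsewhere both compare
-- alike with `z`, and at `i` only `y` disagrees with it.
hamming-step : ∀ {p} (x y z : Vec Bool p) i → hamming x y ≡ 1 →
               lookup x i ≢ lookup y i → lookup z i ≡ lookup x i →
               hamming y z ≡ suc (hamming x z)
hamming-step (a ∷ x) (b ∷ y) (.a ∷ z) zero h a≢b refl with a Bool.≟ b
... | yes a≡b = contradiction a≡b a≢b
... | no _ with refl ← hamming≡0⇒≡ x y (suc-injective h) with b Bool.≟ a | a Bool.≟ a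
...   | yes b≡a | _     = contradiction (sym b≡a) a≢b
...   | no _    | yes _ = refl
...   | no _    | no ne = contradiction refl ne
hamming-step (a ∷ x) (b ∷ y) (c ∷ z) (suc i) h ne eq with a Bool.≟ b
-- A difference at the head uses up the whole distance, so the tails cannot differ at `i`.
... | no _ = contradiction (cong (λ t → lookup t i) (hamming≡0⇒≡ x y (suc-injective h))) ne
... | yes refl with a Bool.≟ c
...   | yes _ = hamming-step x y z i h ne eq
...   | no _  = cong suc (hamming-step x y z i h ne eq)

module _ {A : Set} {f g : A → Bool} where

  hamming-map≡0 : ∀ {xs : List A} → All (λ x → f x ≡ g x) xs →
                  hamming (map f (fromList xs)) (map g (fromList xs)) ≡ 0
  hamming-map≡0 []                 = refl
  hamming-map≡0 {x ∷ _} (eq ∷ eqs) with f x Bool.≟ g x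
  ... | yes _ = hamming-map≡0 eqs
  ... | no ne = contradiction eq ne

  -- The pairwise hypothesis allows at most one entry where `f` and `g` disagree; `Any` supplies
  -- one.
  hamming-map≡1 : ∀ {xs : List A} →
                  AllPairs (λ x y → f x ≢ g x → f y ≡ g y) xs →
                  Any (λ x → f x ≢ g x) xs →
                  hamming (map f (fromList xs)) (map g (fromList xs)) ≡ 1
  hamming-map≡1 {x ∷ _} (eqs ∷ pairs) any with f x Bool.≟ g x | any
  ... | yes eq | here ne   = contradiction eq ne
  ... | yes _  | there any = hamming-map≡1 pairs any
  ... | no ne  | _         = cong suc (hamming-map≡0 (All.map (λ k → k ne) eqs))

≢-≢⇒≡ : ∀ {a b c : Bool} → a ≢ b → a ≢ c → b ≡ c
≢-≢⇒≡ a≢b a≢c = Bool.not-injective (trans (sym (Bool.¬-not a≢b)) (Bool.¬-not a≢c))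

-- The relations are arbitrary: for S = djokovićCut, IsClassOf S is IsDjokovićCut.
IsClassOf-cong : {E : Set} {R S : Rel E 0ℓ} → (∀ e → R e ≐ S e) →
                 ∀ F → IsClassOf R F ⇔ IsClassOf S F
IsClassOf-cong R≐S F = mk⇔ (λ (e , F≐) → e , ≐-trans F≐ (R≐S e))
                           (λ (e , F≐) → e , ≐-trans F≐ (≐-sym (R≐S e)))

-- Distances in a connected graph.

module _ {n : ℕ} (G : Graph n) (conn : Connected G) where

  open Graph G
  open Metric G conn

  dist≡0⇒≡ : ∀ {u v} → dist u v ≡ 0 → u ≡ v
  dist≡0⇒≡ {u} {v} eq with [] ← subst (Walk G u v) eq (geodesic u v) = refl

  dist-adjacent : ∀ {u v} → u ~ v → dist u v ≡ 1
  dist-adjacent a = ≤-antisym (dist-minimal (a ∷ []))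
    (n≢0⇒n>0 λ eq → ~-irrefl (subst (_ ~_) (sym (dist≡0⇒≡ eq)) a))

  -- Edges of a partial cube, sorted by the coordinate they flip.

  module PartialCube {p} (label : Fin n → Vec Bool p)
                     (isometric : ∀ u v → dist u v ≡ hamming (label u) (label v)) where

    bit : Fin p → Fin n → Bool
    bit i w = lookup (label w) i

    Crosses : Fin p → Pred (Edge G) 0ℓ
    Crosses i (edge u v _) = bit i u ≢ bit i v

    dist-sym : ∀ u v → dist u v ≡ dist v u
    dist-sym u v = trans (isometric u v) (trans (hamming-sym (label u) (label v)) (sym (isometric v u)))

    direction : ∀ e → ∃[ i ] Crosses i e
    direction (edge u v a) = hamming≢0⇒differ (label u) (label v) λ eq →
      1+n≢0 (trans (sym (dist-adjacent a)) (trans (isometric u v) eq))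

    closer : ∀ {i u v w} → u ~ v → bit i u ≢ bit i v → bit i w ≡ bit i u →
             dist v w ≡ suc (dist u w)
    closer {i} {u} {v} {w} a ne eq =
      trans (isometric v w)
        (trans (hamming-step (label u) (label v) (label w) i
                 (trans (sym (isometric u v)) (dist-adjacent a)) ne eq)
               (cong suc (sym (isometric u w))))

    -- Of the two namings of an edge that crosses `i`, this selects the one running in the same
    -- direction as `e`. It suffices to compute `φ` and `θ` there, since the flip lemmas give the
    -- other naming.
    Along : Fin p → Rel (Edge G) 0ℓ
    Along i (edge u v _) (edge x y _) = bit i x ≡ bit i u × bit i y ≡ bit i v

    along-or-against : ∀ {i} e f → Crosses i e → Crosses i f →
                       Along i e f ⊎ Along i e (flip G f)
    along-or-against {i} (edge u v _) (edge x y _) u≢v x≢y with bit i x Bool.≟ bit i u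
    ... | yes x≡u = inj₁ (x≡u , ≢-≢⇒≡ x≢y (u≢v ∘ trans (sym x≡u)))
    ... | no  x≢u = inj₂ (≢-≢⇒≡ x≢y x≢u , ≢-≢⇒≡ (x≢u ∘ sym) u≢v)

    -- Moving from `u` to `v` seen from `x`, or from `x` to `y` seen from `u`, adds one to
    -- `dist u x`, so the crossed distances agree. Seen from `y`, `u` is one further than `v`, so
    -- the parallel distances agree too.
    along⇒φ : ∀ {i} e f → Crosses i e → Along i e f → φ e f
    along⇒φ (edge u v a) (edge x y b) u≢v (x≡u , y≡v) = ux≡vy , trans uy≡1+ux (sym vx≡1+ux)
      where
      vx≡1+ux : dist v x ≡ suc (dist u x)
      vx≡1+ux = closer a u≢v x≡u
      uy≡1+vy : dist u y ≡ suc (dist v y)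
      uy≡1+vy = closer (~-sym a) (≢-sym u≢v) y≡v
      uy≡1+ux : dist u y ≡ suc (dist u x)
      uy≡1+ux = trans (dist-sym u y)
        (trans (closer b (λ x≡y → u≢v (trans (sym x≡u) (trans x≡y y≡v))) (sym x≡u))
               (cong suc (dist-sym x u)))
      ux≡vy : dist u x ≡ dist v y
      ux≡vy = suc-injective (trans (sym uy≡1+ux) uy≡1+vy)

    -- Each crossed distance exceeds a parallel one by one, so the crossed sum is strictly larger.
    along⇒θ : ∀ {i} e f → Crosses i e → Along i e f → θ e f
    along⇒θ (edge u v a) (edge x y _) u≢v (x≡u , y≡v) = <⇒≢ (begin-strict
      dist u x + dist v y                  ≡⟨ +-comm (dist u x) _ ⟩
      dist v y + dist u x                  <⟨ +-mono-< (n<1+n _) (n<1+n _) ⟩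
      suc (dist v y) + suc (dist u x)      ≡⟨ cong₂ _+_ (closer (~-sym a) (≢-sym u≢v) y≡v) (closer a u≢v x≡u) ⟨
      dist u y + dist v x                  ∎)
      where open ≤-Reasoning

    crosses⇒φ : ∀ {i} e f → Crosses i e → Crosses i f → φ e f
    crosses⇒φ e f ce cf with along-or-against e f ce cf
    ... | inj₁ al = along⇒φ e f ce al
    ... | inj₂ al = φ-flipʳ {e} {flip G f} (along⇒φ e (flip G f) ce al)

    crosses⇒θ : ∀ {i} e f → Crosses i e → Crosses i f → θ e f
    crosses⇒θ e f ce cf with along-or-against e f ce cf
    ... | inj₁ al = along⇒θ e f ce al
    ... | inj₂ al = θ-flipʳ {e} {flip G f} (along⇒θ e (flip G f) ce al)

    same-side : ∀ {i} e w → Crosses i e → bit i w ≡ bit i (src e) ⊎ bit i w ≡ bit i (tgt e)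
    same-side {i} e w ce with bit i w Bool.≟ bit i (src e)
    ... | yes eq = inj₁ eq
    ... | no  ne = inj₂ (≢-≢⇒≡ (≢-sym ne) ce)

    -- If `x` and `y` had the same bit, both would be nearer to the same end of `e`. Going round
    -- through the two equations of `φ` would then make a distance exceed itself by two.
    φ⇒crosses : ∀ {i} e f → Crosses i e → φ e f → Crosses i f
    φ⇒crosses (edge u v a) (edge x y b) ce (ux≡vy , uy≡vx) x≡y
      with same-side (edge u v a) x ce
    ... | inj₁ x≡u = m≢1+m+n _ (trans ux≡vy (trans (closer a ce (trans (sym x≡y) x≡u))
          (cong suc (trans uy≡vx (trans (closer a ce x≡u) (sym (+-comm _ 1)))))))
    ... | inj₂ x≡v = m≢1+m+n _ (trans (sym ux≡vy) (trans (closer (~-sym a) (≢-sym ce) x≡v)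
          (cong suc (trans (sym uy≡vx) (trans (closer (~-sym a) (≢-sym ce) (trans (sym x≡y) x≡v))
            (sym (+-comm _ 1)))))))

    -- If `x` and `y` had the same bit, exchanging `u` and `v` would shift both distances by one in
    -- the same direction, and the two sums would be equal.
    θ⇒crosses : ∀ {i} e f → Crosses i e → θ e f → Crosses i f
    θ⇒crosses (edge u v a) (edge x y b) ce t x≡y with same-side (edge u v a) x ce
    ... | inj₁ x≡u = t (begin
          dist u x + dist v y        ≡⟨ cong (dist u x +_) (closer a ce (trans (sym x≡y) x≡u)) ⟩
          dist u x + suc (dist u y)  ≡⟨ +-suc (dist u x) _ ⟩
          suc (dist u x) + dist u y  ≡⟨ cong (_+ dist u y) (closer a ce x≡u) ⟨
          dist v x + dist u y        ≡⟨ +-comm (dist v x) _ ⟩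
          dist u y + dist v x        ∎)
      where open ≡-Reasoning
    ... | inj₂ x≡v = t (begin
          dist u x + dist v y        ≡⟨ cong (_+ dist v y) (closer (~-sym a) (≢-sym ce) x≡v) ⟩
          suc (dist v x) + dist v y  ≡⟨ +-suc (dist v x) _ ⟨
          dist v x + suc (dist v y)  ≡⟨ cong (dist v x +_) (closer (~-sym a) (≢-sym ce) (trans (sym x≡y) x≡v)) ⟨
          dist v x + dist u y        ≡⟨ +-comm (dist v x) _ ⟩
          dist u y + dist v x        ∎)
      where open ≡-Reasoning

    φ⇒θ : ∀ e f → φ e f → θ e f
    φ⇒θ e f r = let _ , ce = direction e in crosses⇒θ e f ce (φ⇒crosses e f ce r)

    θ⇒φ : ∀ e f → θ e f → φ e f
    θ⇒φ e f r = let _ , ce = direction e in crosses⇒φ e f ce (θ⇒crosses e f ce r)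

    -- A coordinate crossed by `e` is crossed by every edge related to it, and two edges crossing a
    -- common coordinate are related.
    φ-isEquivalence : IsEquivalence φ
    φ-isEquivalence = record
      { refl  = λ {e} → let _ , ce = direction e in crosses⇒φ e e ce ce
      ; sym   = λ {e} {f} r → let _ , ce = direction e in
                crosses⇒φ f e (φ⇒crosses e f ce r) ce
      ; trans = λ {e} {f} {g} r s → let _ , ce = direction e in
                crosses⇒φ e g ce (φ⇒crosses f g (φ⇒crosses e f ce r) s)
      }

    θ-isEquivalence : IsEquivalence θ
    θ-isEquivalence = record
      { refl  = λ {e} → φ⇒θ e e (φ.refl {e})
      ; sym   = λ {e} {f} r → φ⇒θ f e (φ.sym {e} {f} (θ⇒φ e f r))
      ; trans = λ {e} {f} {g} r s → φ⇒θ e g (φ.trans {e} {f} {g} (θ⇒φ e f r) (θ⇒φ f g s))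
      }
      where module φ = IsEquivalence φ-isEquivalence

    agree⇒W : ∀ {i u v w} → u ~ v → bit i u ≢ bit i v → bit i w ≡ bit i u → W u v w
    agree⇒W {u = u} {v} {w} a ne eq = ≤-reflexive
      (trans (cong suc (dist-sym w u)) (trans (sym (closer a ne eq)) (dist-sym v w)))

    W⇒agree : ∀ {i u v w} → u ~ v → bit i u ≢ bit i v → W u v w → bit i w ≡ bit i u
    W⇒agree {w = w} a ne w∈W with same-side (edge _ _ a) w ne
    ... | inj₁ eq = eq
    ... | inj₂ eq = contradiction w∈W (<-asym (agree⇒W (~-sym a) (≢-sym ne) eq))

    crosses⇒cut : ∀ {i} e f → Crosses i e → Crosses i f → djokovićCut e f
    crosses⇒cut e@(edge _ _ a) f ce cf with along-or-against e f ce cf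
    ... | inj₁ (p , q) = inj₁ (agree⇒W a ce p , agree⇒W (~-sym a) (≢-sym ce) q)
    ... | inj₂ (p , q) = inj₂ (agree⇒W (~-sym a) (≢-sym ce) q , agree⇒W a ce p)

    cut⇒crosses : ∀ {i} e f → Crosses i e → djokovićCut e f → Crosses i f
    cut⇒crosses (edge _ _ a) f ce (inj₁ (p , q)) x≡y = ce
      (trans (sym (W⇒agree a ce p)) (trans x≡y (W⇒agree (~-sym a) (≢-sym ce) q)))
    cut⇒crosses (edge _ _ a) f ce (inj₂ (p , q)) x≡y = ce
      (trans (sym (W⇒agree a ce q)) (trans (sym x≡y) (W⇒agree (~-sym a) (≢-sym ce) p)))

    φ≐cut : ∀ e → φ e ≐ djokovićCut e
    φ≐cut e with direction e
    ... | _ , ce = (λ {f} r → crosses⇒cut e f ce (φ⇒crosses e f ce r))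
                 , (λ {f} r → crosses⇒φ e f ce (cut⇒crosses e f ce r))

  -- Finite enumeration of the edges up to `φ`.

  φ? : ∀ e f → Dec (φ e f)
  φ? (edge u v _) (edge x y _) = (dist u x ≟ dist v y) ×-dec (dist u y ≟ dist v x)

  edgesBetween : Fin n × Fin n → List (Edge G)
  edgesBetween (u , v) with u ~? v
  ... | yes a = edge u v a ∷ []
  ... | no _  = []

  edges : List (Edge G)
  edges = concatMap edgesBetween (cartesianProduct (allFin n) (allFin n))

  -- Adjacency may have several proofs, so that an edge need not itself be
  -- listed; the listed edge with the same endpoints is only φ-related to it.
  φ-edges : IsEquivalence φ → ∀ e → Any (φ e) edges
  φ-edges eqv e@(edge u v a) =
    concatMap⁺ edgesBetween (lose (∈-cartesianProduct⁺ (∈-allFin u) (∈-allFin v)) listed)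
    where
    listed : Any (φ e) (edgesBetween (u , v))
    listed with u ~? v
    ... | yes _ = here (IsEquivalence.refl eqv {e})
    ... | no ¬a = contradiction a ¬a

  -- Labelling the vertices by the sides of convex cuts.

  module ConvexCuts (eqv : IsEquivalence φ)
                    (induces : ∀ e → InducesConvexEdgeCut (φ e)) where

    module φ = IsEquivalence eqv

    φ-decSetoid : DecSetoid 0ℓ 0ℓ
    φ-decSetoid = record { isDecEquivalence = record { isEquivalence = eqv ; _≟_ = φ? } }

    -- Positions in this list of class representatives serve as the coordinates of the hypercube.
    classes : List (Edge G)
    classes = deduplicate φ? edges

    classes-distinct : AllPairs (λ e f → ¬ φ e f) classes
    classes-distinct = deduplicate-! φ-decSetoid edges

    classes-cover : ∀ e → Any (φ e) classes
    classes-cover e = deduplicate⁺ φ?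
      -- An edge dropped as a duplicate is `φ`-related to the one kept, so being related to `e`
      -- carries over.
      (λ {f} {g} s r → φ.trans {e} {f} {g} r (φ.sym {g} {f} s)) (φ-edges eqv e)

    side : Edge G → Fin n → Bool
    side e = lookup (proj₁ (induces e))

    label : Fin n → Vec Bool (length classes)
    label w = map (λ e → side e w) (fromList classes)

    ∈⇒side : ∀ e {w} → w ∈ₛ proj₁ (induces e) → side e w ≡ true
    ∈⇒side e = []=⇒lookup

    ∈∁⇒side : ∀ e {w} → w ∈ₛ ∁ (proj₁ (induces e)) → side e w ≡ false
    ∈∁⇒side e {w} w∈∁ = Bool.¬-not (x∈∁p⇒x∉p w∈∁ ∘ lookup⇒[]= w _)

    separates⇒φ : ∀ e f → side e (src f) ≢ side e (tgt f) → φ e f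
    separates⇒φ e f ne with induces e | ne
    ... | A , (_ , cut⊆φ) , _ | ne
      with src f ∈? A | tgt f ∈? A
    ... | yes p | yes q = contradiction (trans ([]=⇒lookup p) (sym ([]=⇒lookup q))) ne
    ... | yes p | no  q = cut⊆φ {f} (inj₁ (p , x∉p⇒x∈∁p q))
    ... | no  p | yes q = cut⊆φ {f} (inj₂ (x∉p⇒x∈∁p p , q))
    ... | no  p | no  q = contradiction
          (≢-≢⇒≡ (p ∘ lookup⇒[]= (src f) A ∘ sym) (q ∘ lookup⇒[]= (tgt f) A ∘ sym)) ne

    φ⇒separates : ∀ e f → φ e f → side e (src f) ≢ side e (tgt f)
    φ⇒separates e f r eq with proj₁ (proj₁ (proj₂ (induces e))) {f} r
    ... | inj₁ (p , q) with () ← trans (sym (∈⇒side e p)) (trans eq (∈∁⇒side e q))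
    ... | inj₂ (p , q) with () ← trans (sym (∈⇒side e q)) (trans (sym eq) (∈∁⇒side e p))

    -- Both sides are convex, so it does not matter which one contains the two ends. The length is a
    -- variable `k` with an equation so that the walk can be given as `a ∷ p`.
    geodesic-side : ∀ e {u v w k} (p : Walk G u v k) → k ≡ dist u v → _∈ʷ_ G w p →
                    side e u ≡ side e v → side e w ≡ side e u
    geodesic-side e {u} {v} p refl w∈p eq with induces e | eq
    ... | A , _ , A-convex , ∁A-convex | eq with u ∈? A
    ... | yes u∈A = trans ([]=⇒lookup (A-convex u∈A v∈A p w∈p)) (sym ([]=⇒lookup u∈A))
      where v∈A = lookup⇒[]= v A (trans (sym eq) ([]=⇒lookup u∈A))
    ... | no u∉A = ≢-≢⇒≡ (x∈∁p⇒x∉p w∈∁A ∘ lookup⇒[]= _ A ∘ sym) (u∉A ∘ lookup⇒[]= _ A ∘ sym)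
      where
      v∉A = λ v∈A → u∉A (lookup⇒[]= u A (trans eq ([]=⇒lookup v∈A)))
      w∈∁A = ∁A-convex (x∉p⇒x∈∁p u∉A) (x∉p⇒x∈∁p v∉A) p w∈p

    start-∈ʷ : ∀ {u v k} (p : Walk G u v k) → _∈ʷ_ G u p
    start-∈ʷ []      = end
    start-∈ʷ (_ ∷ _) = here

    -- Two representatives separating `u` from `v` would be related through the edge `f`, against
    -- `classes-distinct`; `classes-cover` provides one that does separate them.
    hamming-adjacent : ∀ {u v} → u ~ v → hamming (label u) (label v) ≡ 1
    hamming-adjacent {u} {v} a = hamming-map≡1
      (AllPairs.map (λ {e} {g} ¬eg ne → decidable-stable (side g u Bool.≟ side g v)
         λ ne′ → ¬eg
           (φ.trans {e} {f} {g} (separates⇒φ e f ne) (φ.sym {g} {f} (separates⇒φ g f ne′))))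
         classes-distinct)
      (Any.map (λ {e} r → φ⇒separates e f (φ.sym {f} {e} r)) (classes-cover f))
      where f = edge u v a

    hamming-geodesic : ∀ {u v k} → Walk G u v k → k ≡ dist u v →
                       k ≡ hamming (label u) (label v)
    hamming-geodesic {u} [] _ = sym (hamming-refl (label u))
    hamming-geodesic {u} {v} (_∷_ {w = w} {k = k} a p) eq
      with i , ne ← hamming≢0⇒differ (label w) (label u)
             (λ h≡0 → 1+n≢0 (trans (sym (hamming-adjacent (~-sym a))) h≡0)) =
      trans (cong suc (hamming-geodesic p k≡dist))
        (sym (hamming-step (label w) (label u) (label v) i (hamming-adjacent (~-sym a)) ne v≡w))
      where
      k≡dist : k ≡ dist w v
      -- The tail of a geodesic is a geodesic: prefixing `a` to a shorter walk from `w` would beat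
      -- `dist u v`.
      k≡dist = ≤-antisym
        (s≤s⁻¹ (≤-trans (≤-reflexive eq) (dist-minimal (a ∷ geodesic w v))))
        (dist-minimal p)
      bit-side : ∀ x → lookup (label x) i ≡ side (lookup (fromList classes) i) x
      bit-side x = lookup-map i (λ e → side e x) (fromList classes)
      -- Otherwise `v` and `u` lie on one side of the cut at `i`; convexity puts `w` there as well,
      -- although the first edge flips `i`.
      v≡w : lookup (label v) i ≡ lookup (label w) i
      v≡w with lookup (label v) i Bool.≟ lookup (label w) i
      ... | yes eq′ = eq′
      ... | no v≢w  = contradiction
            (trans (bit-side w) (trans
              (geodesic-side (lookup (fromList classes) i) (a ∷ p) eq (there (start-∈ʷ p))
                (trans (sym (bit-side u)) (trans (≢-≢⇒≡ ne (≢-sym v≢w)) (bit-side v))))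
              (sym (bit-side u))))
            ne

    isPartialCube : IsPartialCube
    isPartialCube = length classes , label , λ u v → hamming-geodesic (geodesic u v) refl

theorem2 : ∀ {n : ℕ} (G : Graph n) (conn : Connected G) →
    let open Metric G conn in
    (IsPartialCube →
    (∀ e f → φ e f ⇔ θ e f) ×
    IsEquivalence φ ×
    (∀ (F : Pred (Edge G) 0ℓ) → IsClassOf φ F ⇔ IsDjokovićCut F)) ×
    (Bipartite G →
    IsEquivalence φ →
    (∀ (F : Pred (Edge G) 0ℓ) → IsClassOf φ F → InducesConvexEdgeCut F) →
    IsPartialCube ×
    IsEquivalence θ ×
    (∀ (F : Pred (Edge G) 0ℓ) → IsClassOf θ F ⇔ IsClassOf φ F))
theorem2 G conn =
  (λ (_ , label , isometric) →
    let open PartialCube G conn label isometric in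
      (λ e f → mk⇔ (φ⇒θ e f) (θ⇒φ e f))
    , φ-isEquivalence
    , IsClassOf-cong φ≐cut) ,
  (λ _ eqv induces →
    let open ConvexCuts G conn eqv (λ e → induces (Metric.φ G conn e) (e , (λ {f} r → r) , (λ {f} r → r)))
        -- The labelling just built makes the first half applicable, which identifies `θ` with `φ`.
        open PartialCube G conn label (proj₂ (proj₂ isPartialCube))
    in isPartialCube
     , θ-isEquivalence
     , IsClassOf-cong λ e → (λ {f} → θ⇒φ e f) , (λ {f} → φ⇒θ e f))
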